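{- Let $T\in\mathbb{Z}^d$ be a fixed vector, and let $f:([m]^d)^3\to\{0,1\}$ be defined by $f(x,y,z)=1$ if and only if $x+y+z=T$ (addition in $\mathbb{Z}^d$). Then the three-player number-on-the-forehead protocol for $f$ described in the context is correct: on every input $(x,y,z)\in([m]^d)^3$ it outputs $f(x,y,z)$.
   Context: $m,d\ge 1$ are integers and $[m]=\{1,\dots,m\}$. In the number-on-the-forehead (NOF) model, on input $(x,y,z)$ player 1 sees $y,z$, player 2 sees $x,z$, and player 3 sees $x,y$; the players communicate by writing on a blackboard visible to all. The protocol is as follows. (1) Player 1 computes $v_x=(T-y-z)+2y+3z$. (2) Player 2 computes $v_y=x+2(T-x-z)+3z$. (3) Player 3 computes $v_z=x+2y+3(T-x-y)$. (All computations are in $\mathbb{Z}^d$.) (4) Player 1 writes $\|v_x\|_2^2$ on the blackboard. (5) Player 2 writes $1$ if $\|v_y\|_2^2=\|v_x\|_2^2$ and $0$ otherwise. (6) Player 3 writes $1$ if $\|v_z\|_2^2=\|v_x\|_2^2$ and $0$ otherwise. (7) The protocol outputs $1$ if the last two bits written are both equal to $1$, and $0$ otherwise. -}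

module Defs where

open import Data.Bool.Base using (Bool; _∧_)
open import Data.Fin.Base using (Fin; toℕ)
open import Data.Integer.Base using (ℤ; +_; 0ℤ; _+_; _-_; _*_)
import Data.Integer.Properties as ℤ
open import Data.Nat.Base using (ℕ; suc)
open import Data.Product.Base using (_×_; _,_)
open import Data.Vec.Base using (Vec; map; zipWith; foldr′)
import Data.Vec.Properties as Vec
open import Relation.Binary.Definitions using (DecidableEquality)
open import Relation.Nullary.Decidable using (does)

infixl 6 _+ᵥ_ _-ᵥ_
infixl 7 _·ᵥ_
infix  4 _≟ᵥ_

ℤ^ : ℕ → Set
ℤ^ d = Vec ℤ d

_+ᵥ_ _-ᵥ_ : ∀ {d} → ℤ^ d → ℤ^ d → ℤ^ d
_+ᵥ_ = zipWith _+_
_-ᵥ_ = zipWith _-_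

_·ᵥ_ : ∀ {d} → ℤ → ℤ^ d → ℤ^ d
c ·ᵥ v = map (c *_) v

‖_‖² : ∀ {d} → ℤ^ d → ℤ
‖ v ‖² = foldr′ _+_ 0ℤ (map (λ a → a * a) v)

_≟ᵥ_ : ∀ {d} → DecidableEquality (ℤ^ d)
_≟ᵥ_ = Vec.≡-dec ℤ._≟_

-- [m] = {1,…,m} is represented by Fin m, whose element i stands for
-- the integer 1 + toℕ i.
[_]^_ : ℕ → ℕ → Set
[ m ]^ d = Vec (Fin m) d

⟦_⟧ : ∀ {m d} → [ m ]^ d → ℤ^ d
⟦_⟧ = map (λ i → + suc (toℕ i))

data Player : Set where
  player₁ player₂ player₃ : Player

-- Each player sees every input but the one on their own forehead.
see : ∀ {A : Set} → Player → A × A × A → A × A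
see player₁ (x , y , z) = y , z
see player₂ (x , y , z) = x , z
see player₃ (x , y , z) = x , y

-- Deterministic three-player number-on-the-forehead protocols.  In
-- `write i msg next`, player i writes on the blackboard a message computed
-- from what they see.  The rest of the protocol may depend on
-- the message, so everything already on the blackboard is known to all
-- players, and the output is a function of the blackboard alone.
data NOF (A B : Set) : Set₁ where
  output : B → NOF A B
  write  : {M : Set} (i : Player) (msg : A × A → M) (next : M → NOF A B) →
           NOF A B

run : ∀ {A B} → NOF A B → A × A × A → B
run (output b)         xyz = b
run (write i msg next) xyz = run (next (msg (see i xyz))) xyz

-- Bits are Booleans, with 1 as true and 0 as false.
f : ∀ {m d} → ℤ^ d → [ m ]^ d × [ m ]^ d × [ m ]^ d → Bool
f T (x , y , z) = does (⟦ x ⟧ +ᵥ ⟦ y ⟧ +ᵥ ⟦ z ⟧ ≟ᵥ T)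

module _ {m d : ℕ} (T : ℤ^ d) where

  vˣ vʸ vᶻ : [ m ]^ d × [ m ]^ d → ℤ^ d
  vˣ (y , z) = (T -ᵥ ⟦ y ⟧ -ᵥ ⟦ z ⟧) +ᵥ + 2 ·ᵥ ⟦ y ⟧ +ᵥ + 3 ·ᵥ ⟦ z ⟧
  vʸ (x , z) = ⟦ x ⟧ +ᵥ + 2 ·ᵥ (T -ᵥ ⟦ x ⟧ -ᵥ ⟦ z ⟧) +ᵥ + 3 ·ᵥ ⟦ z ⟧
  vᶻ (x , y) = ⟦ x ⟧ +ᵥ + 2 ·ᵥ ⟦ y ⟧ +ᵥ + 3 ·ᵥ (T -ᵥ ⟦ x ⟧ -ᵥ ⟦ y ⟧)

  protocol : NOF ([ m ]^ d) Bool
  protocol =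
    write player₁ (λ yz → ‖ vˣ yz ‖²)                 λ n  →
    write player₂ (λ xz → does (‖ vʸ xz ‖² ℤ.≟ n))    λ b₂ →
    write player₃ (λ xy → does (‖ vᶻ xy ‖² ℤ.≟ n))    λ b₃ →
    output (b₂ ∧ b₃)

{-# OPTIONS --safe #-}
-- Put w = T − (x + y + z).  The three vectors are the arithmetic progression
-- v, v + w, (v + w) + w.  The second difference of ‖_‖² along it is 2‖w‖²,
-- so the three norms agree exactly when w = 0.
module Submission where

open import Defs
open import Algebra.Bundles using (AbelianGroup)
open import Algebra.Properties.Group using (identityʳ-unique)
open import Data.Fin.Base using (toℕ)
open import Data.Integer.Base
  using (+_; -[1+_]; 0ℤ; _+_; _-_; _*_; +≤+) renaming (_≤_ to _≤ℤ_)
import Data.Integer.Properties as ℤ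
open import Data.Integer.Tactic.RingSolver using (solve-∀)
open import Data.Nat.Base using (ℕ; suc; _≤_; z≤n)
open import Data.Product.Base using (_×_; _,_)
open import Data.Sum.Base using (reduce)
open import Data.Vec.Base using ([]; _∷_; head; tail; replicate)
open import Data.Vec.Properties using (zipWith-identityʳ)
open import Function.Bundles using (_⇔_; mk⇔)
open import Function.Construct.Composition using (_⇔-∘_)
open import Relation.Binary.PropositionalEquality
  using (_≡_; refl; sym; trans; cong; cong₂; subst; subst₂; module ≡-Reasoning)
open import Relation.Nullary.Decidable using (does-⇔; _×-dec_)

0ᵥ : ∀ {d} → ℤ^ d
0ᵥ = replicate _ 0ℤ

0≤i*i : ∀ i → 0ℤ ≤ℤ i * i
0≤i*i (+ n)    = subst (0ℤ ≤ℤ_) (ℤ.pos-* n n) (+≤+ z≤n)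
0≤i*i -[1+ n ] = +≤+ z≤n

‖‖²-nonneg : ∀ {d} (v : ℤ^ d) → 0ℤ ≤ℤ ‖ v ‖²
‖‖²-nonneg []      = +≤+ z≤n
‖‖²-nonneg (a ∷ v) = ℤ.+-mono-≤ (0≤i*i a) (‖‖²-nonneg v)

i+j≡0⇒i≡0 : ∀ {i j} → 0ℤ ≤ℤ i → 0ℤ ≤ℤ j → i + j ≡ 0ℤ → i ≡ 0ℤ
i+j≡0⇒i≡0 {i} {j} 0≤i 0≤j i+j≡0 = ℤ.≤-antisym
  (subst₂ _≤ℤ_ (ℤ.+-identityʳ i) i+j≡0 (ℤ.+-monoʳ-≤ i 0≤j)) 0≤i

‖v‖²≡0⇒v≡0 : ∀ {d} (v : ℤ^ d) → ‖ v ‖² ≡ 0ℤ → v ≡ 0ᵥ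
‖v‖²≡0⇒v≡0 []      _  = refl
‖v‖²≡0⇒v≡0 (a ∷ v) eq = cong₂ _∷_
  -- Both factors of the vanishing product are `a`, so `reduce` merges the two alternatives.
  (reduce (ℤ.i*j≡0⇒i≡0∨j≡0 a (i+j≡0⇒i≡0 (0≤i*i a) (‖‖²-nonneg v) eq)))
  (‖v‖²≡0⇒v≡0 v (i+j≡0⇒i≡0 (‖‖²-nonneg v) (0≤i*i a)
    (trans (ℤ.+-comm ‖ v ‖² (a * a)) eq)))

-- The parallelogram law for `v +ᵥ w` and `w`, with the difference of the two already simplified to
-- `v`. It holds coordinate by coordinate.
second-difference : ∀ {d} (v w : ℤ^ d) →
  ‖ v +ᵥ w +ᵥ w ‖² + ‖ v ‖² ≡ + 2 * ‖ v +ᵥ w ‖² + + 2 * ‖ w ‖²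
second-difference []      []      = refl
second-difference (a ∷ v) (b ∷ w) = begin
  ((a + b + b) * (a + b + b) + P) + (a * a + Q)
    ≡⟨ regroup a b P Q ⟩
  (P + Q) + + 2 * ((a + b) * (a + b)) + + 2 * (b * b)
    ≡⟨ cong (λ s → s + + 2 * ((a + b) * (a + b)) + + 2 * (b * b))
         (second-difference v w) ⟩
  (+ 2 * R + + 2 * S) + + 2 * ((a + b) * (a + b)) + + 2 * (b * b)
    ≡⟨ distribute a b R S ⟩
  + 2 * ((a + b) * (a + b) + R) + + 2 * (b * b + S) ∎
  where
  open ≡-Reasoning
  -- The norms of the tails enter the ring identities only as opaque integers.
  P = ‖ v +ᵥ w +ᵥ w ‖²
  Q = ‖ v ‖²
  R = ‖ v +ᵥ w ‖²
  S = ‖ w ‖²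
  regroup : ∀ a b p q → ((a + b + b) * (a + b + b) + p) + (a * a + q) ≡
    (p + q) + + 2 * ((a + b) * (a + b)) + + 2 * (b * b)
  regroup = solve-∀
  distribute : ∀ a b r s →
    (+ 2 * r + + 2 * s) + + 2 * ((a + b) * (a + b)) + + 2 * (b * b) ≡
    + 2 * ((a + b) * (a + b) + r) + + 2 * (b * b + s)
  distribute = solve-∀

progression-norms : ∀ {d} (v w : ℤ^ d) →
  (‖ v +ᵥ w ‖² ≡ ‖ v ‖² × ‖ v +ᵥ w +ᵥ w ‖² ≡ ‖ v ‖²) ⇔ w ≡ 0ᵥ
progression-norms v w = mk⇔ to from
  where
  v+0≡v : v +ᵥ 0ᵥ ≡ v
  v+0≡v = zipWith-identityʳ ℤ.+-identityʳ v

  double : ∀ n → + 2 * n ≡ n + n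
  double = solve-∀

  to : ‖ v +ᵥ w ‖² ≡ ‖ v ‖² × ‖ v +ᵥ w +ᵥ w ‖² ≡ ‖ v ‖² → w ≡ 0ᵥ
  -- Equal norms turn the second difference into 2‖v‖² + 2‖w‖² = 2‖v‖². Cancelling 2‖v‖² and then
  -- the factor 2 leaves ‖w‖² = 0; `+ 2 * 0ℤ` computes to `0ℤ`.
  to (eq₁ , eq₂) = ‖v‖²≡0⇒v≡0 w (ℤ.*-cancelˡ-≡ (+ 2) ‖ w ‖² 0ℤ
    (identityʳ-unique (AbelianGroup.group ℤ.+-0-abelianGroup) (+ 2 * ‖ v ‖²) (+ 2 * ‖ w ‖²) (begin
      + 2 * ‖ v ‖² + + 2 * ‖ w ‖²        ≡⟨ cong (λ n → + 2 * n + + 2 * ‖ w ‖²) eq₁ ⟨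
      + 2 * ‖ v +ᵥ w ‖² + + 2 * ‖ w ‖²   ≡⟨ second-difference v w ⟨
      ‖ v +ᵥ w +ᵥ w ‖² + ‖ v ‖²          ≡⟨ cong (_+ ‖ v ‖²) eq₂ ⟩
      ‖ v ‖² + ‖ v ‖²                    ≡⟨ double ‖ v ‖² ⟨
      + 2 * ‖ v ‖²                       ∎)))
    where open ≡-Reasoning

  from : w ≡ 0ᵥ → ‖ v +ᵥ w ‖² ≡ ‖ v ‖² × ‖ v +ᵥ w +ᵥ w ‖² ≡ ‖ v ‖²
  from refl = cong ‖_‖² v+0≡v ,
              cong ‖_‖² (trans (cong (_+ᵥ 0ᵥ) v+0≡v) v+0≡v)

u-v≡0⇔v≡u : ∀ {d} (u v : ℤ^ d) → u -ᵥ v ≡ 0ᵥ ⇔ v ≡ u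
u-v≡0⇔v≡u u v = mk⇔ (to u v) λ { refl → v-v≡0 v }
  where
  to : ∀ {d} (u v : ℤ^ d) → u -ᵥ v ≡ 0ᵥ → v ≡ u
  to []      []      _  = refl
  to (a ∷ u) (b ∷ v) eq = cong₂ _∷_
    (sym (ℤ.i-j≡0⇒i≡j a b (cong head eq))) (to u v (cong tail eq))
  v-v≡0 : ∀ {d} (v : ℤ^ d) → v -ᵥ v ≡ 0ᵥ
  v-v≡0 []      = refl
  v-v≡0 (a ∷ v) = cong₂ _∷_ (ℤ.+-inverseʳ a) (v-v≡0 v)

-- The common difference of the progression. It refers to all three inputs, so it serves the
-- analysis and not the protocol.
defect : ∀ {m d} → ℤ^ d → (x y z : [ m ]^ d) → ℤ^ d
defect T x y z = T -ᵥ (⟦ x ⟧ +ᵥ ⟦ y ⟧ +ᵥ ⟦ z ⟧)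

-- Each player replaces the unseen input by its value plus the defect w. With u = x + 2y + 3z, the
-- coefficients 1, 2, 3 make the three vectors u + w, u + 2w and u + 3w.
vʸ≡vˣ+defect : ∀ {m d} (T : ℤ^ d) (x y z : [ m ]^ d) →
  vʸ T (x , z) ≡ vˣ T (y , z) +ᵥ defect T x y z
vʸ≡vˣ+defect []      []      []      []      = refl
vʸ≡vˣ+defect (t ∷ T) (i ∷ x) (j ∷ y) (k ∷ z) =
  cong₂ _∷_ (identity t (+ suc (toℕ i)) (+ suc (toℕ j)) (+ suc (toℕ k)))
    (vʸ≡vˣ+defect T x y z)
  where
  identity : ∀ t a b c → a + + 2 * (t - a - c) + + 3 * c ≡
    (t - b - c) + + 2 * b + + 3 * c + (t - (a + b + c))
  identity = solve-∀

vᶻ≡vʸ+defect : ∀ {m d} (T : ℤ^ d) (x y z : [ m ]^ d) →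
  vᶻ T (x , y) ≡ vʸ T (x , z) +ᵥ defect T x y z
vᶻ≡vʸ+defect []      []      []      []      = refl
vᶻ≡vʸ+defect (t ∷ T) (i ∷ x) (j ∷ y) (k ∷ z) =
  cong₂ _∷_ (identity t (+ suc (toℕ i)) (+ suc (toℕ j)) (+ suc (toℕ k)))
    (vᶻ≡vʸ+defect T x y z)
  where
  identity : ∀ t a b c → a + + 2 * b + + 3 * (t - a - b) ≡
    a + + 2 * (t - a - c) + + 3 * c + (t - (a + b + c))
  identity = solve-∀

accepts⇔sum≡T : ∀ {m d} (T : ℤ^ d) (x y z : [ m ]^ d) →
  (‖ vʸ T (x , z) ‖² ≡ ‖ vˣ T (y , z) ‖² × ‖ vᶻ T (x , y) ‖² ≡ ‖ vˣ T (y , z) ‖²)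
  ⇔ ⟦ x ⟧ +ᵥ ⟦ y ⟧ +ᵥ ⟦ z ⟧ ≡ T
accepts⇔sum≡T T x y z
  -- The order matters: the first rewrite introduces a new `vʸ`, which the second one expands
  -- together with the original.
  rewrite vᶻ≡vʸ+defect T x y z | vʸ≡vˣ+defect T x y z =
  u-v≡0⇔v≡u T (⟦ x ⟧ +ᵥ ⟦ y ⟧ +ᵥ ⟦ z ⟧)
    ⇔-∘ progression-norms (vˣ T (y , z)) (defect T x y z)

lemma20 : (m d : ℕ) → 1 ≤ m → 1 ≤ d → (T : ℤ^ d) (x y z : [ m ]^ d) →
    run (protocol T) (x , y , z) ≡ f T (x , y , z)
lemma20 m d _ _ T x y z = does-⇔ (accepts⇔sum≡T T x y z)
  -- `does` of a `×-dec` is the `∧` of the two bits, so this decision computes to the output of the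
  -- run.
  ((‖ vʸ T (x , z) ‖² ℤ.≟ ‖ vˣ T (y , z) ‖²) ×-dec
   (‖ vᶻ T (x , y) ‖² ℤ.≟ ‖ vˣ T (y , z) ‖²))
  (⟦ x ⟧ +ᵥ ⟦ y ⟧ +ᵥ ⟦ z ⟧ ≟ᵥ T)
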